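{- Let $r \ge 3$ be an integer. Every $r$-free digraph $G$ satisfies $\beta(G) \le 800\,\gamma(G)/r^2$.
   Context: A digraph $G=(V_G,E_G)$ has a finite vertex set and a set $E_G$ of ordered pairs $(u,v)$ of vertices (edges); it has no loops and no parallel edges (two opposite edges $(u,v),(v,u)$ are allowed). A directed cycle of length $\ell\ge 2$ consists of distinct vertices $v_1,\dots,v_\ell$ with edges $(v_i,v_{i+1})$ for $1\le i\le \ell-1$ and $(v_\ell,v_1)$. For $r\ge 2$, a digraph is $r$-free if it contains no directed cycle of length at most $r$. $\beta(G)$ denotes the minimum size of a feedback arc set, i.e. the minimum $|X|$ over $X\subseteq E_G$ such that $G\setminus X$ has no directed cycle. $\gamma(G)$ denotes the number of unordered pairs of distinct vertices of $G$ that are not adjacent (no edge in either direction between them). -}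

module Defs where

open import Data.Nat using (ℕ; zero; suc; _+_; _*_; _≤_; _<_; _<ᵇ_)
open import Data.Bool using (Bool; true; false; if_then_else_; _∧_; not)
open import Data.Fin using (Fin; zero; suc; toℕ; inject₁; fromℕ)
open import Data.List using (List; map; allFin)
open import Data.Nat.ListAction using (sum)
open import Data.Empty using (⊥)
open import Data.Product using (Σ; _×_; ∃)
open import Relation.Binary.PropositionalEquality using (_≡_)
open import Relation.Nullary using (¬_)
open import Function.Definitions using (Injective)

-- A digraph on the vertex set Fin n: edge relation as a Boolean matrix
-- (E u v ≡ true  iff  (u,v) is an edge), with no loops.
-- Parallel edges cannot be represented; opposite edges are allowed.
record Digraph (n : ℕ) : Set where
  field
    edge     : Fin n → Fin n → Bool
    loopless : ∀ v → edge v v ≡ false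
open Digraph public

-- A directed cycle of length (suc k) (with k ≥ 1, i.e. length ≥ 2) in the
-- edge relation E: distinct vertices c 0, …, c k with edges
-- (c i, c (i+1)) for i < k, and the closing edge (c k, c 0).
record DirCycle {n : ℕ} (E : Fin n → Fin n → Bool) (k : ℕ) : Set where
  field
    vtx      : Fin (suc k) → Fin n
    distinct : Injective _≡_ _≡_ vtx
    path     : ∀ (i : Fin k) → E (vtx (inject₁ i)) (vtx (suc i)) ≡ true
    closing  : E (vtx (fromℕ k)) (vtx zero) ≡ true

HasCycleOfLength : {n : ℕ} → (Fin n → Fin n → Bool) → ℕ → Set
HasCycleOfLength E zero = ⊥
HasCycleOfLength E (suc zero) = ⊥
HasCycleOfLength E (suc (suc k)) = DirCycle E (suc k)

Acyclic : {n : ℕ} → (Fin n → Fin n → Bool) → Set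
Acyclic E = ∀ ℓ → ¬ HasCycleOfLength E ℓ

RFree : {n : ℕ} → ℕ → Digraph n → Set
RFree r G = ∀ ℓ → ℓ ≤ r → ¬ HasCycleOfLength (edge G) ℓ

countPairs : {n : ℕ} → (Fin n → Fin n → Bool) → ℕ
countPairs {n} M =
  sum (map (λ u → sum (map (λ v → if M u v then 1 else 0) (allFin n))) (allFin n))

IsFeedbackArcSet : {n : ℕ} → Digraph n → (Fin n → Fin n → Bool) → Set
IsFeedbackArcSet G X =
  (∀ u v → X u v ≡ true → edge G u v ≡ true)
  × Acyclic (λ u v → edge G u v ∧ not (X u v))

gamma : {n : ℕ} → Digraph n → ℕ
gamma {n} G = countPairs (λ u v →
  (toℕ u <ᵇ toℕ v) ∧ not (edge G u v) ∧ not (edge G v u))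

-- It suffices to split every nonempty vertex set into two parts S , T such that the number of edges
-- from S to T is at most 800/r² times the number of non-adjacent pairs between them: these edges are
-- removed, T is ranked before S, and one recurses. The cuts used are the balls of radius i < r around
-- a vertex v; a vertex without in-neighbours is split off alone instead.
--
-- If r ≤ 28 then 800/r² ≥ 1, and averaging over v works with i = 1: a path v → x → y contributing
-- an edge to the cut of v contributes the non-adjacent pair {v , y} to the cut of x.
--
-- If r ≥ 29, take v with the least number δ of non-neighbours. The vertices at distance 2 , … , r - 1
-- from v are non-neighbours of v, so some band of about r/2 consecutive layers has at most δ/2
-- vertices. Each vertex of the band then has at least δ/4 non-neighbours beyond the band or at least
-- δ/4 before it. If no cut inside the band were sparse, consecutive layer sizes would satisfy
-- r² aᵢ aᵢ₊₁ ≥ 100 δ (a₁ + … + aᵢ) when counted away from a suitable layer; so the partial sums would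
-- grow quadratically and exceed the size of the band.
module Submission where

open import Defs
open import Data.Bool using (Bool; true; if_then_else_; T; not; _∧_)
import Data.Bool.Properties as Bool
open import Data.Empty using (⊥; ⊥-elim)
open import Data.Fin using (Fin; zero; suc; toℕ; inject₁; fromℕ)
import Data.Fin.Properties as Fin
import Data.List as List
open import Data.List.Properties using (map-tabulate)
import Data.Nat.ListAction as ListAction
open import Data.Nat using (ℕ; zero; suc; _+_; _*_; _∸_; _≤_; _<_; _≤?_; _<?_; _<ᵇ_; z≤n; s≤s; >-nonZero)
open import Data.Nat.DivMod using (_/_; _%_; m≡m%n+[m/n]*n; m%n<n; m/n*n≤m; /-monoˡ-≤)
open import Data.Nat.Induction using (<-wellFounded)
open import Data.Nat.Properties
open import Algebra.Properties.Semiring.Sum +-*-semiring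
  using (sum; sum-cong-≗; sum-replicate-zero; *-distribˡ-sum; *-distribʳ-sum; ∑-distrib-+; ∑-comm)
open import Data.Nat.Tactic.RingSolver using (solve-∀)
open import Data.Product using (Σ; ∃; _×_; _,_; proj₁; proj₂)
open import Data.Sum using (_⊎_; inj₁; inj₂; [_,_]′)
open import Data.Unit using (⊤; tt)
open import Function using (_∘_; flip; id; case_of_)
open import Induction.WellFounded using (Acc; acc)
open import Level using (0ℓ)
open import Relation.Binary.Definitions using (tri<; tri≈; tri>)
open import Relation.Binary.PropositionalEquality
open import Relation.Nullary using (¬_; Dec; does; proof; yes; no; Reflects; invert)
open import Relation.Nullary.Decidable using (_×-dec_; _⊎-dec_; T?; ¬?; map′; toSum; dec-true)
open import Relation.Unary using (Pred; Decidable)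

private
  variable
    n : ℕ
    A B C : Set
    P Q R : Pred (Fin n) 0ℓ
    P₂ Q₂ R₂ : Fin n → Fin n → Set

-- Counting with decidable predicates

𝟙 : Dec A → ℕ
𝟙 a? = if does a? then 1 else 0

if-yes : (a? : Dec A) {x y : B} → A → (if does a? then x else y) ≡ x
if-yes (yes _) _ = refl
if-yes (no ¬a) a = ⊥-elim (¬a a)

if-no : (a? : Dec A) {x y : B} → ¬ A → (if does a? then x else y) ≡ y
if-no (yes a) ¬a = ⊥-elim (¬a a)
if-no (no _)  _  = refl

𝟙-pos : (a? : Dec A) → 0 < 𝟙 a? → A
𝟙-pos (yes a) _ = a

𝟙-mono : (a? : Dec A) (b? : Dec B) → (A → B) → 𝟙 a? ≤ 𝟙 b?
𝟙-mono (no _)  _       _ = z≤n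
𝟙-mono (yes _) (yes _) _ = ≤-refl
𝟙-mono (yes a) (no ¬b) f = ⊥-elim (¬b (f a))

𝟙-cover : (a? : Dec A) (b? : Dec B) (c? : Dec C) → (A → B ⊎ C) → 𝟙 a? ≤ 𝟙 b? + 𝟙 c?
𝟙-cover (no _)  _       _       _ = z≤n
𝟙-cover (yes _) (yes _) _       _ = s≤s z≤n
𝟙-cover (yes _) (no _)  (yes _) _ = ≤-refl
𝟙-cover (yes a) (no ¬b) (no ¬c) f = ⊥-elim ([ ¬b , ¬c ]′ (f a))

𝟙-disjoint : (a? : Dec A) (b? : Dec B) (c? : Dec C) →
             (A → C) → (B → C) → (A → B → ⊥) → 𝟙 a? + 𝟙 b? ≤ 𝟙 c?
𝟙-disjoint (no _)  b?      c?      _ g _ = 𝟙-mono b? c? g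
𝟙-disjoint (yes a) (yes b) _       _ _ k = ⊥-elim (k a b)
𝟙-disjoint (yes _) (no _)  (yes _) _ _ _ = ≤-refl
𝟙-disjoint (yes a) (no _)  (no ¬c) f _ _ = ⊥-elim (¬c (f a))

sum-mono-≤ : {f g : Fin n → ℕ} → (∀ i → f i ≤ g i) → sum f ≤ sum g
sum-mono-≤ {zero}  _ = z≤n
sum-mono-≤ {suc _} p = +-mono-≤ (p zero) (sum-mono-≤ (p ∘ suc))

sum-mono-< : {f g : Fin n → ℕ} → (∀ i → f i ≤ g i) → ∀ i → f i < g i → sum f < sum g
sum-mono-< p zero    q = +-mono-<-≤ q (sum-mono-≤ (p ∘ suc))
sum-mono-< p (suc i) q = +-mono-≤-< (p zero) (sum-mono-< (p ∘ suc) i q)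

sum-tabulate : ∀ {n} (f : Fin n → ℕ) → ListAction.sum (List.tabulate f) ≡ sum f
sum-tabulate {zero}  f = refl
sum-tabulate {suc n} f = cong (f zero +_) (sum-tabulate (f ∘ suc))

sum-allFin : ∀ {n} (f : Fin n → ℕ) → ListAction.sum (List.map f (List.allFin n)) ≡ sum f
sum-allFin f = trans (cong ListAction.sum (map-tabulate id f)) (sum-tabulate f)

opaque

  # : {P : Pred (Fin n) 0ℓ} → Decidable P → ℕ
  # P? = sum (λ u → 𝟙 (P? u))

  ## : {R : Fin n → Fin n → Set} → (∀ u v → Dec (R u v)) → ℕ
  ## R? = sum (λ u → # (R? u))

  #-mono : (P? : Decidable P) (Q? : Decidable Q) → (∀ {u} → P u → Q u) → # P? ≤ # Q?
  #-mono P? Q? f = sum-mono-≤ λ u → 𝟙-mono (P? u) (Q? u) f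

  #-mono-< : (P? : Decidable P) (Q? : Decidable Q) → (∀ {u} → P u → Q u) →
             ∀ u → ¬ P u → Q u → # P? < # Q?
  #-mono-< P? Q? f u ¬p q = sum-mono-< (λ v → 𝟙-mono (P? v) (Q? v) f) u strict
    where
    strict : 𝟙 (P? u) < 𝟙 (Q? u)
    strict = subst₂ _<_ (sym (if-no (P? u) ¬p)) (sym (if-yes (Q? u) q)) ≤-refl

  #-cover : (P? : Decidable P) (Q? : Decidable Q) (R? : Decidable R) →
            (∀ {u} → P u → Q u ⊎ R u) → # P? ≤ # Q? + # R?
  #-cover P? Q? R? f = begin
    # P?                              ≤⟨ sum-mono-≤ (λ u → 𝟙-cover (P? u) (Q? u) (R? u) f) ⟩
    sum (λ u → 𝟙 (Q? u) + 𝟙 (R? u))   ≡⟨ ∑-distrib-+ (λ u → 𝟙 (Q? u)) (λ u → 𝟙 (R? u)) ⟩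
    # Q? + # R?                       ∎
    where open ≤-Reasoning

  #-disjoint : (P? : Decidable P) (Q? : Decidable Q) (R? : Decidable R) →
               (∀ {u} → P u → R u) → (∀ {u} → Q u → R u) → (∀ {u} → P u → Q u → ⊥) →
               # P? + # Q? ≤ # R?
  #-disjoint P? Q? R? f g k = begin
    # P? + # Q?                       ≡⟨ ∑-distrib-+ (λ u → 𝟙 (P? u)) (λ u → 𝟙 (Q? u)) ⟨
    sum (λ u → 𝟙 (P? u) + 𝟙 (Q? u))   ≤⟨ sum-mono-≤ (λ u → 𝟙-disjoint (P? u) (Q? u) (R? u) f g k) ⟩
    # R?                              ∎
    where open ≤-Reasoning

  #-empty : (P? : Decidable P) → (∀ u → ¬ P u) → # P? ≡ 0
  #-empty {zero}  P? ¬P = refl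
  #-empty {suc _} P? ¬P = cong₂ _+_ (if-no (P? zero) (¬P zero)) (#-empty (P? ∘ suc) (¬P ∘ suc))

  ##-mono : (P? : ∀ u v → Dec (P₂ u v)) (Q? : ∀ u v → Dec (Q₂ u v)) →
            (∀ {u v} → P₂ u v → Q₂ u v) → ## P? ≤ ## Q?
  ##-mono P? Q? f = sum-mono-≤ λ u → #-mono (P? u) (Q? u) f

  ##-cover : (P? : ∀ u v → Dec (P₂ u v)) (Q? : ∀ u v → Dec (Q₂ u v)) (R? : ∀ u v → Dec (R₂ u v)) →
             (∀ {u v} → P₂ u v → Q₂ u v ⊎ R₂ u v) → ## P? ≤ ## Q? + ## R?
  ##-cover P? Q? R? f = begin
    ## P?                              ≤⟨ sum-mono-≤ (λ u → #-cover (P? u) (Q? u) (R? u) f) ⟩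
    sum (λ u → # (Q? u) + # (R? u))    ≡⟨ ∑-distrib-+ (λ u → # (Q? u)) (λ u → # (R? u)) ⟩
    ## Q? + ## R?                      ∎
    where open ≤-Reasoning

  ##-disjoint : (P? : ∀ u v → Dec (P₂ u v)) (Q? : ∀ u v → Dec (Q₂ u v)) (R? : ∀ u v → Dec (R₂ u v)) →
                (∀ {u v} → P₂ u v → R₂ u v) → (∀ {u v} → Q₂ u v → R₂ u v) →
                (∀ {u v} → P₂ u v → Q₂ u v → ⊥) → ## P? + ## Q? ≤ ## R?
  ##-disjoint P? Q? R? f g k = begin
    ## P? + ## Q?                      ≡⟨ ∑-distrib-+ (λ u → # (P? u)) (λ u → # (Q? u)) ⟨
    sum (λ u → # (P? u) + # (Q? u))    ≤⟨ sum-mono-≤ (λ u → #-disjoint (P? u) (Q? u) (R? u) f g k) ⟩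
    ## R?                              ∎
    where open ≤-Reasoning

  ##-empty : ∀ {n} {P₂ : Fin n → Fin n → Set} (P? : ∀ u v → Dec (P₂ u v)) → (∀ u v → ¬ P₂ u v) → ## P? ≡ 0
  ##-empty {n} P? ¬P = trans (sum-cong-≗ (λ u → #-empty (P? u) (¬P u))) (sum-replicate-zero n)

  ##-swap : (P? : ∀ u v → Dec (P₂ u v)) → ## P? ≡ ## (flip P?)
  ##-swap P? = ∑-comm (λ u v → 𝟙 (P? u v))

  ##-× : ∀ {n} {P Q : Pred (Fin n) 0ℓ} (P? : Decidable P) (Q? : Decidable Q) →
         ## (λ u v → P? u ×-dec Q? v) ≡ # P? * # Q?
  ##-× {n} P? Q? = trans (sum-cong-≗ pointwise) (sym (*-distribʳ-sum (# Q?) (λ u → 𝟙 (P? u))))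
    where
    pointwise : ∀ u → # (λ v → P? u ×-dec Q? v) ≡ 𝟙 (P? u) * # Q?
    pointwise u with P? u
    ... | yes _ = sym (*-identityˡ (# Q?))
    ... | no _  = sum-replicate-zero n

  #-*-≤-## : (P? : Decidable P) (R? : ∀ u v → Dec (R₂ u v)) (k d : ℕ) →
             (∀ {u} → P u → d ≤ k * # (R? u)) → d * # P? ≤ k * ## R?
  #-*-≤-## P? R? k d f = begin
    d * # P?                     ≡⟨ *-distribˡ-sum d (λ u → 𝟙 (P? u)) ⟩
    sum (λ u → d * 𝟙 (P? u))     ≤⟨ sum-mono-≤ pointwise ⟩
    sum (λ u → k * # (R? u))     ≡⟨ *-distribˡ-sum k (λ u → # (R? u)) ⟨
    k * ## R?                    ∎
    where
    open ≤-Reasoning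
    pointwise : ∀ u → d * 𝟙 (P? u) ≤ k * # (R? u)
    pointwise u with P? u
    ... | yes p = ≤-trans (≤-reflexive (*-identityʳ d)) (f p)
    ... | no _  = ≤-trans (≤-reflexive (*-zeroʳ d)) z≤n

  ##-rotate : ∀ {n} {T₃ : Fin n → Fin n → Fin n → Set} (T? : ∀ x y z → Dec (T₃ x y z)) →
              sum (λ z → ## (λ x y → T? x y z)) ≡ sum (λ x → ## (T? x))
  ##-rotate T? = trans
    (∑-comm (λ z x → sum λ y → 𝟙 (T? x y z)))
    (sum-cong-≗ (λ x → ∑-comm (λ z y → 𝟙 (T? x y z))))

  countPairs-does : {R : Fin n → Fin n → Set} (R? : ∀ u v → Dec (R u v)) →
                    countPairs (λ u v → does (R? u v)) ≡ ## R?
  countPairs-does R? = trans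
    (sum-allFin (λ u → ListAction.sum (List.map (λ v → 𝟙 (R? u v)) (List.allFin _))))
    (sum-cong-≗ (λ u → sum-allFin (λ v → 𝟙 (R? u v))))

-- Descent along `f` stops because its values are natural numbers. `A` may be infinite; each search
-- over it is delegated to `smaller?`.
minimal : (f : A → ℕ) → (∀ a → Dec (∃ λ b → f b < f a)) → A → ∃ λ a → ∀ b → f a ≤ f b
minimal {A} f smaller? a = go a (<-wellFounded (f a))
  where
  go : ∀ a → Acc _<_ (f a) → ∃ λ a → ∀ b → f a ≤ f b
  go a (acc rs) with smaller? a
  ... | yes (b , b<a) = go b (rs b<a)
  ... | no ¬smaller   = a , λ b → ≮⇒≥ λ b<a → ¬smaller (b , b<a)

-- Quadratic growth

-- Writing the larger number as the smaller plus `d`, the two sides differ by exactly `d * d`.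
amgm : ∀ x y → 4 * (x * y) ≤ (x + y) * (x + y)
amgm x y with ≤-total x y
... | inj₁ x≤y with d , refl ← m≤n⇒∃[o]m+o≡n x≤y =
  ≤-trans (m≤m+n _ (d * d)) (≤-reflexive (expand x d))
  where
  expand : ∀ x d → 4 * (x * (x + d)) + d * d ≡ (x + (x + d)) * (x + (x + d))
  expand = solve-∀
... | inj₂ y≤x with d , refl ← m≤n⇒∃[o]m+o≡n y≤x =
  ≤-trans (m≤m+n _ (d * d)) (≤-reflexive (expand y d))
  where
  expand : ∀ y d → 4 * ((y + d) * y) + d * d ≡ (y + d + y) * (y + d + y)
  expand = solve-∀

halve : ∀ x y {d} → x + y ≤ d → 2 * x ≤ d ⊎ 2 * y ≤ d
halve x y x+y≤d with ≤-total x y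
... | inj₁ x≤y = inj₁ (≤-trans (+-monoʳ-≤ x (≤-trans (≤-reflexive (+-identityʳ x)) x≤y)) x+y≤d)
... | inj₂ y≤x = inj₂ (≤-trans (+-mono-≤ y≤x (≤-reflexive (+-identityʳ y))) x+y≤d)

square-cancel-≤ : ∀ {x y} → x * x ≤ y * y → x ≤ y
square-cancel-≤ xx≤yy = ≮⇒≥ λ y<x → ≤⇒≯ xx≤yy (*-mono-< y<x y<x)

prefix : (ℕ → ℕ) → ℕ → ℕ
prefix a zero    = 0
prefix a (suc t) = prefix a t + a t

module Growth (R D m : ℕ) (a : ℕ → ℕ)
  (expand : ∀ t → suc t < m → 0 < a t × 4 * D * prefix a (suc t) ≤ R * (a t * a (suc t))) where

  private
    -- Here `prefix a 1` is `a 0`, which is positive and cancels from the hypothesis at `t = 0`.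
    first-step : 1 < m → D * 1 ≤ R * prefix a 2
    first-step 1<m with a₀>0 , h ← expand 0 1<m = begin
      D * 1             ≡⟨ *-identityʳ D ⟩
      D                 ≤⟨ m≤m+n D _ ⟩
      4 * D             ≤⟨ *-cancelʳ-≤ (4 * D) (R * a 1) (a 0) {{>-nonZero a₀>0}} scaled ⟩
      R * a 1           ≤⟨ *-monoʳ-≤ R (m≤n+m (a 1) (a 0)) ⟩
      R * prefix a 2    ∎
      where
      open ≤-Reasoning
      reorder : ∀ R x y → R * (x * y) ≡ R * y * x
      reorder = solve-∀
      scaled : 4 * D * a 0 ≤ R * a 1 * a 0
      scaled = ≤-trans h (≤-reflexive (reorder R (a 0) (a 1)))

    -- Two terms are added at a time because `(t + 2)² - t² = 4 (t + 1)`. Their sum `x + y` is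
    -- bounded through its square: `(x + y)² ≥ 4 x y`, and the hypothesis with `IH₁` bounds `x y`
    -- from below.
    next-step : ∀ t → suc (suc t) < m → D * (t * t) ≤ R * prefix a (suc t) →
                D * (suc t * suc t) ≤ R * prefix a (suc (suc t)) →
                D * (suc (suc t) * suc (suc t)) ≤ R * prefix a (suc (suc (suc t)))
    next-step t lt IH₀ IH₁ = begin
      D * (suc (suc t) * suc (suc t))           ≡⟨ split D t ⟩
      D * (t * t) + 4 * D * suc t               ≤⟨ +-mono-≤ IH₀ increment ⟩
      R * prefix a (suc t) + R * (x + y)        ≡⟨ regroup R (prefix a (suc t)) x y ⟩
      R * prefix a (suc (suc (suc t)))          ∎
      where
      open ≤-Reasoning
      x y : ℕ
      x = a (suc t)
      y = a (suc (suc t))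
      split : ∀ D t → D * ((2 + t) * (2 + t)) ≡ D * (t * t) + 4 * D * (1 + t)
      split = solve-∀
      regroup : ∀ R p x y → R * p + R * (x + y) ≡ R * (p + x + y)
      regroup = solve-∀
      lhs : ∀ D s → 4 * D * s * (4 * D * s) ≡ 4 * (4 * D * (D * (s * s)))
      lhs = solve-∀
      mid : ∀ D R p → 4 * (4 * D * (R * p)) ≡ 4 * R * (4 * D * p)
      mid = solve-∀
      rhs : ∀ R q → 4 * R * (R * q) ≡ R * R * (4 * q)
      rhs = solve-∀
      fin : ∀ R z → R * R * (z * z) ≡ R * z * (R * z)
      fin = solve-∀
      increment : 4 * D * suc t ≤ R * (x + y)
      increment = square-cancel-≤ (begin
        4 * D * suc t * (4 * D * suc t)               ≡⟨ lhs D (suc t) ⟩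
        4 * (4 * D * (D * (suc t * suc t)))           ≤⟨ *-monoʳ-≤ 4 (*-monoʳ-≤ (4 * D) IH₁) ⟩
        4 * (4 * D * (R * prefix a (suc (suc t))))    ≡⟨ mid D R (prefix a (suc (suc t))) ⟩
        4 * R * (4 * D * prefix a (suc (suc t)))      ≤⟨ *-monoʳ-≤ (4 * R) (proj₂ (expand (suc t) lt)) ⟩
        4 * R * (R * (x * y))                         ≡⟨ rhs R (x * y) ⟩
        R * R * (4 * (x * y))                         ≤⟨ *-monoʳ-≤ (R * R) (amgm x y) ⟩
        R * R * ((x + y) * (x + y))                   ≡⟨ fin R (x + y) ⟩
        R * (x + y) * (R * (x + y))                   ∎)

  quadratic-growth : ∀ t → t < m → D * (t * t) ≤ R * prefix a (suc t)
  quadratic-growth zero          _  = ≤-trans (≤-reflexive (*-zeroʳ D)) z≤n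
  quadratic-growth (suc zero)    lt = first-step lt
  quadratic-growth (suc (suc t)) lt =
    next-step t lt (quadratic-growth t (m+n≤o⇒n≤o 2 lt)) (quadratic-growth (suc t) (m+n≤o⇒n≤o 1 lt))

-- Cuts inside a thin band of layers

module Layers {n : ℕ} {W : Pred (Fin n) 0ℓ} (W? : Decidable W) (h : Fin n → ℕ) where

  level? : ∀ i → Decidable (λ u → W u × h u ≡ i)
  level? i u = W? u ×-dec h u ≟ i

  band? : ∀ i j → Decidable (λ u → W u × i < h u × h u ≤ j)
  band? i j u = W? u ×-dec i <? h u ×-dec h u ≤? j

  low? : ∀ i → Decidable (λ u → W u × h u ≤ i)
  low? i u = W? u ×-dec h u ≤? i

  high? : ∀ i → Decidable (λ u → W u × i < h u)
  high? i u = W? u ×-dec i <? h u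

  cross? : {R : Fin n → Fin n → Set} → (∀ u v → Dec (R u v)) → ∀ i u v →
           Dec (((W u × h u ≤ i) × (W v × i < h v)) × R u v)
  cross? R? i u v = (low? i u ×-dec high? i v) ×-dec R? u v

  cross : {R : Fin n → Fin n → Set} → (∀ u v → Dec (R u v)) → ℕ → ℕ
  cross R? i = ## (cross? R? i)

  band-snoc : ∀ i j → i ≤ j → # (band? i j) + # (level? (suc j)) ≤ # (band? i (suc j))
  band-snoc i j i≤j = #-disjoint (band? i j) (level? (suc j)) (band? i (suc j))
    (λ (w , l , u) → w , l , m≤n⇒m≤1+n u)
    (λ (w , eq) → w , ≤-trans (s≤s i≤j) (≤-reflexive (sym eq)) , ≤-reflexive eq)
    (λ (_ , _ , u) (_ , eq) → 1+n≰n (≤-trans (≤-reflexive (sym eq)) u))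

  band-cons : ∀ i j → i < j → # (band? (suc i) j) + # (level? (suc i)) ≤ # (band? i j)
  band-cons i j i<j = #-disjoint (band? (suc i) j) (level? (suc i)) (band? i j)
    (λ (w , l , u) → w , <⇒≤ l , u)
    (λ (w , eq) → w , ≤-reflexive (sym eq) , ≤-trans (≤-reflexive eq) i<j)
    (λ (_ , l , _) (_ , eq) → 1+n≰n (≤-trans l (≤-reflexive eq)))

factors-pos : ∀ k {x y z} → z < k * (x * y) → 0 < x × 0 < y
factors-pos k {zero}          lt rewrite *-zeroʳ k = ⊥-elim (n≮0 lt)
factors-pos k {suc x} {zero}  lt rewrite *-zeroʳ x | *-zeroʳ k = ⊥-elim (n≮0 lt)
factors-pos k {suc _} {suc _} _  = s≤s z≤n , s≤s z≤n

-- In the application `h` is the distance from a vertex of `W`, `N` is non-adjacency, `R` is `r * r`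
-- and `δ` is the least number of non-neighbours inside `W`. The band consists of the levels
-- `s + 1, … , s + 2m` with `m = k + 1`, so that every cut in it has `m` levels of the band on at
-- least one side.
module Window {n : ℕ} {W : Pred (Fin n) 0ℓ} (W? : Decidable W) (h : Fin n → ℕ)
  {E N : Fin n → Fin n → Set} (E? : ∀ u v → Dec (E u v)) (N? : ∀ u v → Dec (N u v))
  (N-sym : ∀ {u v} → N u v → N v u)
  (h-edge : ∀ {u v} → W u → E u v → h v ≤ suc (h u))
  (R δ s k : ℕ) (R<50k² : R < k * k * 50)
  (degree : ∀ {u} → W u → δ ≤ # (λ v → W? v ×-dec N? u v))
  where

  open Layers W? h

  private
    m e : ℕ
    m = suc k
    e = s + (m + m)

  module _ (thin : 2 * # (band? s e) ≤ δ)
           (expanding : ∀ i → s < i → i < e → cross N? i * 800 < R * cross E? i) where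

    private
      before? : ∀ u → Decidable (λ v → (W v × h v ≤ s) × N u v)
      before? u v = low? s v ×-dec N? u v

      after? : ∀ u → Decidable (λ v → (W v × e < h v) × N u v)
      after? u v = high? e v ×-dec N? u v

      -- The non-neighbours of `u` lie before, inside or after the band, and a thin band holds at
      -- most `δ / 2` of them.
      degree-split : ∀ {u} → W u → 2 * δ ≤ 2 * # (before? u) + 2 * # (after? u) + δ
      degree-split {u} w = begin
        2 * δ                                                     ≤⟨ *-monoʳ-≤ 2 (degree w) ⟩
        2 * # (λ v → W? v ×-dec N? u v)                           ≤⟨ *-monoʳ-≤ 2 outer ⟩
        2 * (# (before? u) + # (λ v → high? s v ×-dec N? u v))    ≤⟨ *-monoʳ-≤ 2 (+-monoʳ-≤ (# (before? u)) inner) ⟩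
        2 * (# (before? u) + (# (band? s e) + # (after? u)))      ≡⟨ regroup (# (before? u)) (# (band? s e)) (# (after? u)) ⟩
        2 * # (before? u) + 2 * # (after? u) + 2 * # (band? s e)  ≤⟨ +-monoʳ-≤ _ thin ⟩
        2 * # (before? u) + 2 * # (after? u) + δ                  ∎
        where
        open ≤-Reasoning
        regroup : ∀ x y z → 2 * (x + (y + z)) ≡ 2 * x + 2 * z + 2 * y
        regroup = solve-∀
        outer : # (λ v → W? v ×-dec N? u v) ≤ # (before? u) + # (λ v → high? s v ×-dec N? u v)
        outer = #-cover (λ v → W? v ×-dec N? u v) (before? u) (λ v → high? s v ×-dec N? u v) cases
          where
          cases : ∀ {v} → W v × N u v → (W v × h v ≤ s) × N u v ⊎ (W v × s < h v) × N u v
          cases {v} (w , nuv) with ≤-<-connex (h v) s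
          ... | inj₁ hv≤s = inj₁ ((w , hv≤s) , nuv)
          ... | inj₂ s<hv = inj₂ ((w , s<hv) , nuv)
        inner : # (λ v → high? s v ×-dec N? u v) ≤ # (band? s e) + # (after? u)
        inner = #-cover (λ v → high? s v ×-dec N? u v) (band? s e) (after? u) cases
          where
          cases : ∀ {v} → (W v × s < h v) × N u v → (W v × s < h v × h v ≤ e) ⊎ (W v × e < h v) × N u v
          cases {v} ((w , s<hv) , nuv) with ≤-<-connex (h v) e
          ... | inj₁ hv≤e = inj₁ (w , s<hv , hv≤e)
          ... | inj₂ e<hv = inj₂ ((w , e<hv) , nuv)

      Forward : Pred (Fin n) 0ℓ
      Forward u = δ ≤ 4 * # (after? u)

      forward? : Decidable Forward
      forward? u = δ ≤? 4 * # (after? u)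

      -- By `degree-split` at least `δ / 2` non-neighbours lie outside the band; if fewer than
      -- `δ / 4` lie after it, the others lie before. Adding `3 * δ` on both sides avoids
      -- subtraction.
      backward : ∀ {u} → W u → ¬ Forward u → δ ≤ 4 * # (before? u)
      backward {u} w ¬fwd = +-cancelʳ-≤ (3 * δ) δ _ (begin
        δ + 3 * δ                                          ≡⟨ double δ ⟩
        2 * (2 * δ)                                        ≤⟨ *-monoʳ-≤ 2 (degree-split w) ⟩
        2 * (2 * # (before? u) + 2 * # (after? u) + δ)     ≡⟨ regroup (# (before? u)) (# (after? u)) δ ⟩
        4 * # (before? u) + (4 * # (after? u) + 2 * δ)     ≤⟨ +-monoʳ-≤ (4 * # (before? u)) (+-monoˡ-≤ (2 * δ) (<⇒≤ (≰⇒> ¬fwd))) ⟩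
        4 * # (before? u) + (δ + 2 * δ)                    ≡⟨⟩
        4 * # (before? u) + 3 * δ                          ∎)
        where
        open ≤-Reasoning
        double : ∀ d → d + 3 * d ≡ 2 * (2 * d)
        double = solve-∀
        regroup : ∀ x y d → 2 * (2 * x + 2 * y + d) ≡ 4 * x + (4 * y + 2 * d)
        regroup = solve-∀

      fwd? : ∀ i → Decidable (λ u → (W u × s < h u × h u ≤ i) × Forward u)
      fwd? i u = band? s i u ×-dec forward? u

      bwd? : ∀ i → Decidable (λ u → (W u × i < h u × h u ≤ e) × ¬ Forward u)
      bwd? i u = band? i e u ×-dec ¬? (forward? u)

      -- Each counted vertex has δ/4 non-neighbours on the other side of the cut at i.
      X : ℕ → ℕ
      X i = # (fwd? i) + # (bwd? i)

      -- A forward vertex at or below level `i` is paired with its non-neighbours beyond `e`,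
      -- another vertex above `i` with its non-neighbours up to `s`. All these pairs straddle the
      -- cut; the two families are disjoint because the lower end is above `s` only in the first.
      X-cross : ∀ i → s ≤ i → i ≤ e → δ * X i ≤ 4 * cross N? i
      X-cross i s≤i i≤e = begin
        δ * (# (fwd? i) + # (bwd? i))                       ≡⟨ *-distribˡ-+ δ _ _ ⟩
        δ * # (fwd? i) + δ * # (bwd? i)                     ≤⟨ +-mono-≤ (#-*-≤-## (fwd? i) F? 4 δ fwd-degree)
                                                                        (#-*-≤-## (bwd? i) B? 4 δ bwd-degree) ⟩
        4 * ## F? + 4 * ## B?                               ≡⟨ cong (λ z → 4 * ## F? + 4 * z) (##-swap B?) ⟩
        4 * ## F? + 4 * ## (flip B?)                        ≡⟨ *-distribˡ-+ 4 (## F?) _ ⟨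
        4 * (## F? + ## (flip B?))                          ≤⟨ *-monoʳ-≤ 4 separated ⟩
        4 * cross N? i                                      ∎
        where
        open ≤-Reasoning
        F? : ∀ u v → Dec (((W u × s < h u × h u ≤ i) × Forward u) × (W v × e < h v) × N u v)
        F? u v = fwd? i u ×-dec after? u v
        B? : ∀ u v → Dec (((W u × i < h u × h u ≤ e) × ¬ Forward u) × (W v × h v ≤ s) × N u v)
        B? u v = bwd? i u ×-dec before? u v
        fwd-degree : ∀ {u} → (W u × s < h u × h u ≤ i) × Forward u → δ ≤ 4 * # (F? u)
        fwd-degree {u} p@(_ , f) = ≤-trans f (*-monoʳ-≤ 4 (#-mono (after? u) (F? u) (p ,_)))
        bwd-degree : ∀ {u} → (W u × i < h u × h u ≤ e) × ¬ Forward u → δ ≤ 4 * # (B? u)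
        bwd-degree {u} p@((w , _) , ¬f) = ≤-trans (backward w ¬f) (*-monoʳ-≤ 4 (#-mono (before? u) (B? u) (p ,_)))
        separated : ## F? + ## (flip B?) ≤ cross N? i
        separated = ##-disjoint F? (flip B?) (cross? N? i)
          (λ (((w , _ , u≤i) , _) , (w′ , e<v) , nuv) → ((w , u≤i) , (w′ , ≤-<-trans i≤e e<v)) , nuv)
          (λ (((w , i<v , _) , _) , (w′ , u≤s) , nvu) → ((w′ , ≤-trans u≤s s≤i) , (w , i<v)) , N-sym nvu)
          (λ (((_ , s<u , _) , _) , _) (_ , (_ , u≤s) , _) → <⇒≱ s<u u≤s)

      -- An edge raises `h` by at most one, so it can cross the cut only from level `i` to level
      -- `i + 1`.
      leave-levels : ∀ i → cross E? i ≤ # (level? i) * # (level? (suc i))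
      leave-levels i = ≤-trans
        (##-mono (cross? E? i) (λ u v → level? i u ×-dec level? (suc i) v) exact)
        (≤-reflexive (##-× (level? i) (level? (suc i))))
        where
        exact : ∀ {u v} → ((W u × h u ≤ i) × (W v × i < h v)) × E u v → (W u × h u ≡ i) × (W v × h v ≡ suc i)
        exact (((wu , u≤i) , (wv , i<v)) , euv) =
          (wu , ≤-antisym u≤i (≤-pred (≤-trans i<v (h-edge wu euv)))) ,
          (wv , ≤-antisym (≤-trans (h-edge wu euv) (s≤s u≤i)) i<v)

      -- The constant 200 is 800 divided by the 4 of `X-cross`.
      level-product : ∀ i → s < i → i < e → δ * 200 * X i < R * (# (level? i) * # (level? (suc i)))
      level-product i s<i i<e = begin-strict
        δ * 200 * X i                                   ≡⟨ regroup δ (X i) ⟩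
        δ * X i * 200                                   ≤⟨ *-monoˡ-≤ 200 (X-cross i (<⇒≤ s<i) (<⇒≤ i<e)) ⟩
        4 * cross N? i * 200                            ≡⟨ rescale (cross N? i) ⟩
        cross N? i * 800                                <⟨ expanding i s<i i<e ⟩
        R * cross E? i                                  ≤⟨ *-monoʳ-≤ R (leave-levels i) ⟩
        R * (# (level? i) * # (level? (suc i)))         ∎
        where
        open ≤-Reasoning
        regroup : ∀ d x → d * 200 * x ≡ d * x * 200
        regroup = solve-∀
        rescale : ∀ x → 4 * x * 200 ≡ x * 800
        rescale = solve-∀

      -- A forward vertex of the band is counted by `X j` because it is at or below `j`, any other
      -- one by `X i` because it is above `i`.
      band-≤-X : ∀ i j → s ≤ i → j ≤ e → # (band? i j) ≤ X i + X j
      band-≤-X i j s≤i j≤e = begin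
        # (band? i j)                ≤⟨ #-cover (band? i j) (fwd? j) (bwd? i) cases ⟩
        # (fwd? j) + # (bwd? i)      ≤⟨ +-mono-≤ (m≤m+n (# (fwd? j)) (# (bwd? j))) (m≤n+m (# (bwd? i)) (# (fwd? i))) ⟩
        X j + X i                    ≡⟨ +-comm (X j) (X i) ⟩
        X i + X j                    ∎
        where
        open ≤-Reasoning
        cases : ∀ {u} → W u × i < h u × h u ≤ j →
                (W u × s < h u × h u ≤ j) × Forward u ⊎ (W u × i < h u × h u ≤ e) × ¬ Forward u
        cases {u} (w , i<u , u≤j) with forward? u
        ... | yes f = inj₁ ((w , ≤-<-trans s≤i i<u , u≤j) , f)
        ... | no ¬f = inj₂ ((w , i<u , ≤-trans u≤j j≤e) , ¬f)

      -- With `D = 25 δ`, growth up to `t = k` gives `25 δ k² ≤ R * prefix a m`, which is at most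
      -- `R δ / 2`. Cancelling `δ`, positive because `a 0` is, contradicts `R < 50 k²`.
      no-growth : 1 < m → (a : ℕ → ℕ) → 2 * prefix a m ≤ δ →
                  ¬ (∀ t → suc t < m → 0 < a t × δ * 100 * prefix a (suc t) ≤ R * (a t * a (suc t)))
      no-growth 1<m a small hyp = <⇒≱ R<50k² (*-cancelʳ-≤ (k * k * 50) R δ {{>-nonZero δ>0}} (begin
        k * k * 50 * δ         ≡⟨ pull δ (k * k) ⟩
        2 * (δ * 25 * (k * k))   ≤⟨ *-monoʳ-≤ 2 (quadratic-growth k ≤-refl) ⟩
        2 * (R * prefix a m)     ≡⟨ swap R (prefix a m) ⟩
        R * (2 * prefix a m)     ≤⟨ *-monoʳ-≤ R small ⟩
        R * δ                    ∎))
        where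
        open ≤-Reasoning
        pull : ∀ d q → q * 50 * d ≡ 2 * (d * 25 * q)
        pull = solve-∀
        swap : ∀ r p → 2 * (r * p) ≡ r * (2 * p)
        swap = solve-∀
        quad : ∀ d → 4 * (d * 25) ≡ d * 100
        quad = solve-∀
        open Growth R (δ * 25) m a (λ t lt → proj₁ (hyp t lt) ,
          ≤-trans (≤-reflexive (cong (_* prefix a (suc t)) (quad δ))) (proj₂ (hyp t lt)))
        prefix-pos : ∀ t → 0 < prefix a (suc t)
        prefix-pos zero    = proj₁ (hyp 0 1<m)
        prefix-pos (suc t) = ≤-trans (prefix-pos t) (m≤m+n _ _)
        δ>0 : 0 < δ
        δ>0 = ≤-trans (prefix-pos k) (≤-trans (m≤n*m _ 2) small)

      bound-by-X : ∀ {N x} → N ≤ x + x → δ * 100 * N ≤ δ * 200 * x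
      bound-by-X {N} {x} N≤2x = ≤-trans (*-monoʳ-≤ (δ * 100) N≤2x) (≤-reflexive (regroup δ x))
        where
        regroup : ∀ d x → d * 100 * (x + x) ≡ d * 200 * x
        regroup = solve-∀

      1<m : 1 < m
      1<m = s≤s (pos k R<50k²)
        where
        pos : ∀ j → R < j * j * 50 → 0 < j
        pos (suc _) _ = s≤s z≤n

      -- At a minimiser i of X, a band between i and j holds at most X i + X j ≤ 2 X j vertices, so that
      -- its size is controlled by the cut at j in either direction from i.
      ascending : ∀ i → s ≤ i → i + m ≤ e → (∀ j → s ≤ j → j ≤ e → X i ≤ X j) → ⊥
      ascending i s≤i i+m≤e least = no-growth 1<m a small step
        where
        -- Bands are open below and closed above, so the levels counted upwards start at `i + 1`.
        a : ℕ → ℕ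
        a t = # (level? (suc (i + t)))
        in-band : ∀ t → prefix a t ≤ # (band? i (i + t))
        in-band zero    = z≤n
        in-band (suc t) rewrite +-suc i t =
          ≤-trans (+-monoˡ-≤ (a t) (in-band t)) (band-snoc i (i + t) (m≤m+n i t))
        small : 2 * prefix a m ≤ δ
        small = ≤-trans (*-monoʳ-≤ 2 (≤-trans (in-band m) (#-mono (band? i (i + m)) (band? s e)
          (λ (w , l , u) → w , ≤-<-trans s≤i l , ≤-trans u i+m≤e)))) thin
        step : ∀ t → suc t < m → 0 < a t × δ * 100 * prefix a (suc t) ≤ R * (a t * a (suc t))
        step t lt rewrite +-suc i t = proj₁ (factors-pos R product) , ≤-trans (bound-by-X prefix-bound) (<⇒≤ product)
          where
          j : ℕ
          j = suc (i + t)
          j<e : j < e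
          j<e = ≤-trans (≤-trans (≤-reflexive (sym (trans (+-suc i (suc t)) (cong suc (+-suc i t))))) (+-monoʳ-≤ i lt)) i+m≤e
          s<j : s < j
          s<j = s≤s (≤-trans s≤i (m≤m+n i t))
          product : δ * 200 * X j < R * (# (level? j) * # (level? (suc j)))
          product = level-product j s<j j<e
          prefix-bound : prefix a (suc t) ≤ X j + X j
          prefix-bound = ≤-trans (in-band (suc t)) (≤-trans
            (≤-reflexive (cong (λ z → # (band? i z)) (+-suc i t)))
            (≤-trans (band-≤-X i j s≤i (<⇒≤ j<e)) (+-monoˡ-≤ (X j) (least j (<⇒≤ s<j) (<⇒≤ j<e)))))

      descending : ∀ i → s + m ≤ i → i ≤ e → (∀ j → s ≤ j → j ≤ e → X i ≤ X j) → ⊥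
      descending i s+m≤i i≤e least = no-growth 1<m a small step
        where
        -- Counting downwards starts with level `i` itself, the closed end. Only `t ≤ m ≤ i`
        -- matters, where the subtraction is not truncated.
        a : ℕ → ℕ
        a t = # (level? (i ∸ t))
        below : ∀ {t} → t ≤ m → s + t ≤ i
        below t≤m = ≤-trans (+-monoʳ-≤ s t≤m) s+m≤i
        s≤i∸ : ∀ {t} → t ≤ m → s ≤ i ∸ t
        s≤i∸ {t} t≤m = ≤-trans (≤-reflexive (sym (m+n∸n≡m s t))) (∸-monoˡ-≤ t (below t≤m))
        pred-level : ∀ {t} → suc t ≤ m → i ∸ t ≡ suc (i ∸ suc t)
        pred-level t<m = +-∸-assoc 1 (m+n≤o⇒n≤o s (below t<m))
        in-band : ∀ t → t ≤ m → prefix a t ≤ # (band? (i ∸ t) i)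
        in-band zero    _   = z≤n
        in-band (suc t) t<m = ≤-trans (+-monoˡ-≤ (a t) (in-band t (<⇒≤ t<m)))
          (subst (λ z → # (band? z i) + # (level? z) ≤ # (band? (i ∸ suc t) i)) (sym (pred-level t<m))
            (band-cons (i ∸ suc t) i (≤-trans (≤-reflexive (sym (pred-level t<m))) (m∸n≤m i t))))
        small : 2 * prefix a m ≤ δ
        small = ≤-trans (*-monoʳ-≤ 2 (≤-trans (in-band m ≤-refl) (#-mono (band? (i ∸ m) i) (band? s e)
          (λ (w , l , u) → w , ≤-<-trans (s≤i∸ ≤-refl) l , ≤-trans u i≤e)))) thin
        step : ∀ t → suc t < m → 0 < a t × δ * 100 * prefix a (suc t) ≤ R * (a t * a (suc t))
        step t lt = proj₁ (factors-pos R product) , ≤-trans (bound-by-X prefix-bound) (<⇒≤ product)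
          where
          j : ℕ
          j = i ∸ suc t
          suc-j : i ∸ t ≡ suc j
          suc-j = pred-level (<⇒≤ lt)
          j<e : j < e
          j<e = ≤-trans (≤-reflexive (sym suc-j)) (≤-trans (m∸n≤m i t) i≤e)
          s<j : s < j
          s<j = ≤-trans (s≤s (s≤i∸ lt)) (≤-reflexive (sym (pred-level lt)))
          -- Seen from above, level `j + 1` is `a t` and level `j` is `a (suc t)`, so the factors
          -- are swapped.
          product : δ * 200 * X j < R * (a t * a (suc t))
          product = ≤-trans (level-product j s<j j<e) (≤-reflexive (cong (R *_)
            (trans (*-comm (# (level? j)) _) (cong (λ z → # (level? z) * # (level? j)) (sym suc-j)))))
          prefix-bound : prefix a (suc t) ≤ X j + X j
          prefix-bound = ≤-trans (in-band (suc t) (<⇒≤ lt))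
            (≤-trans (band-≤-X j i (<⇒≤ s<j) i≤e) (+-monoʳ-≤ (X j) (least j (<⇒≤ s<j) (<⇒≤ j<e))))

      -- The minimiser is sought as an offset from `s`, which makes the search a bounded one.
      least-X : ∃ λ d → d ≤ m + m × (∀ j → s ≤ j → j ≤ e → X (s + d) ≤ X j)
      least-X = proj₁ least , proj₂ least , λ j s≤j j≤e → ≤-trans
        (proj₂ minimum (j ∸ s , ≤-trans (∸-monoˡ-≤ s j≤e) (≤-reflexive (m+n∸m≡n s (m + m)))))
        (≤-reflexive (cong X (m+[n∸m]≡n s≤j)))
        where
        Offset : Set
        Offset = ∃ λ d → d ≤ m + m
        smaller? : (a : Offset) → Dec (∃ λ (b : Offset) → X (s + proj₁ b) < X (s + proj₁ a))
        smaller? a = map′ (λ (d , lt , p) → (d , ≤-pred lt) , p) (λ ((d , le) , p) → d , s≤s le , p)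
          (anyUpTo? (λ d → X (s + d) <? X (s + proj₁ a)) (suc (m + m)))
        minimum : ∃ λ (a : Offset) → ∀ b → X (s + proj₁ a) ≤ X (s + proj₁ b)
        minimum = minimal (X ∘ (s +_) ∘ proj₁) smaller? (0 , z≤n)
        least : Offset
        least = proj₁ minimum

    -- A minimiser in the lower half of the band has `m` of its levels above it, one in the upper
    -- half has `m` of them at or below it.
    thin-band-expands⇒⊥ : ⊥
    thin-band-expands⇒⊥ = [ upwards , downwards ]′ (≤-total d m)
      where
      d : ℕ
      d = proj₁ least-X
      least : ∀ j → s ≤ j → j ≤ e → X (s + d) ≤ X j
      least = proj₂ (proj₂ least-X)
      upwards : d ≤ m → ⊥
      upwards d≤m = ascending (s + d) (m≤m+n s d)
        (≤-trans (≤-reflexive (+-assoc s d m)) (+-monoʳ-≤ s (+-monoˡ-≤ m d≤m))) least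
      downwards : m ≤ d → ⊥
      downwards m≤d = descending (s + d) (+-monoʳ-≤ s m≤d) (+-monoʳ-≤ s (proj₁ (proj₂ least-X))) least

-- Truncated distances

-- `r` is the default when none of `0, … , r - 1` satisfies `P`, so only a value below `r` comes
-- with a witness.
first : {P : Pred ℕ 0ℓ} → Decidable P → ℕ → ℕ
first P? zero    = zero
first P? (suc r) = if does (P? 0) then 0 else suc (first (P? ∘ suc) r)

first-≤ : {P : Pred ℕ 0ℓ} (P? : Decidable P) (r : ℕ) → first P? r ≤ r
first-≤ P? zero    = z≤n
first-≤ P? (suc r) with P? 0
... | yes _ = z≤n
... | no _  = s≤s (first-≤ (P? ∘ suc) r)

first-holds : {P : Pred ℕ 0ℓ} (P? : Decidable P) (r : ℕ) → first P? r < r → P (first P? r)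
first-holds P? (suc r) lt with P? 0
... | yes p = p
... | no _  = first-holds (P? ∘ suc) r (≤-pred lt)

first-least : {P : Pred ℕ 0ℓ} (P? : Decidable P) (r : ℕ) {k : ℕ} → P k → first P? r ≤ k
first-least P? zero    p = z≤n
first-least P? (suc r) p with P? 0
first-least P? (suc r)         p | yes _  = z≤n
first-least P? (suc r) {zero}  p | no ¬p₀ = ⊥-elim (¬p₀ p)
first-least P? (suc r) {suc k} p | no _   = s≤s (first-least (P? ∘ suc) r p)

module Edges {n : ℕ} (G : Digraph n) where

  Edge : Fin n → Fin n → Set
  Edge u v = edge G u v ≡ true

  edge? : ∀ u v → Dec (Edge u v)
  edge? u v = edge G u v Bool.≟ true

  loop-free : ∀ {u} → ¬ Edge u u
  loop-free {u} e with () ← trans (sym e) (loopless G u)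

  NonAdj : Fin n → Fin n → Set
  NonAdj u v = u ≢ v × ¬ Edge u v × ¬ Edge v u

  nonAdj? : ∀ u v → Dec (NonAdj u v)
  nonAdj? u v = ¬? (u Fin.≟ v) ×-dec ¬? (edge? u v) ×-dec ¬? (edge? v u)

  nonAdj-sym : ∀ {u v} → NonAdj u v → NonAdj v u
  nonAdj-sym (u≢v , ¬uv , ¬vu) = u≢v ∘ sym , ¬vu , ¬uv

module Distance {n : ℕ} (G : Digraph n) {W : Pred (Fin n) 0ℓ} (W? : Decidable W) (r : ℕ) (v : Fin n) where

  open Edges G

  private
    -- Walks with exactly `j` edges and possible repetitions. Every vertex left by an edge lies in
    -- `W`; the last one need not.
    Walk : ℕ → Pred (Fin n) 0ℓ
    Walk zero    u = u ≡ v
    Walk (suc j) u = ∃ λ x → W x × Walk j x × Edge x u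

    walk? : ∀ j → Decidable (Walk j)
    walk? zero    u = u Fin.≟ v
    walk? (suc j) u = Fin.any? λ x → W? x ×-dec walk? j x ×-dec edge? x u

  -- The distance from v inside W, truncated at r.
  dist : Fin n → ℕ
  dist u = first (λ j → walk? j u) r

  dist-root : dist v ≡ 0
  dist-root = n≤0⇒n≡0 (first-least (λ j → walk? j v) r refl)

  -- A shortest walk to `x` extends along the edge. If the distance of `x` has reached the cap `r`,
  -- the cap also bounds the distance of `y`.
  dist-edge : ∀ {x y} → W x → Edge x y → dist y ≤ suc (dist x)
  dist-edge {x} {y} w e with <-≤-connex (dist x) r
  ... | inj₁ near = first-least (λ j → walk? j y) r (x , w , first-holds (λ j → walk? j x) r near , e)
  ... | inj₂ far  = ≤-trans (first-≤ (λ j → walk? j y) r) (m≤n⇒m≤1+n far)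

  dist-zero : ∀ {u} → dist u ≡ 0 → 0 < r → u ≡ v
  dist-zero {u} d≡0 r>0 = subst (λ j → Walk j u) d≡0
    (first-holds (λ j → walk? j u) r (≤-trans (≤-reflexive (cong suc d≡0)) r>0))

  -- `x` is the last vertex but one of a walk realising `dist u`, which exists because this distance
  -- is below the cap. The walk bounds `dist x` from above, `dist-edge` from below.
  dist-pred : ∀ {u j} → dist u ≡ suc j → suc j < r → ∃ λ x → Edge x u × dist x ≡ j
  dist-pred {u} {j} d≡ lt
    with x , w , walk , e ← subst (λ j → Walk j u) d≡
           (first-holds (λ j → walk? j u) r (≤-trans (≤-reflexive (cong suc d≡)) lt))
    = x , e , ≤-antisym (first-least (λ j → walk? j x) r walk)
        (≤-pred (≤-trans (≤-reflexive (sym d≡)) (dist-edge w e)))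

  -- The path is a total function of which only the values up to `j` matter. It is built by
  -- appending `u` to a geodesic to its predecessor.
  geodesic : ∀ j {u} → dist u ≡ j → j < r → ∃ λ (p : ℕ → Fin n) →
             p j ≡ u × (∀ t → t < j → Edge (p t) (p (suc t))) × (∀ t → t ≤ j → dist (p t) ≡ t)
  geodesic zero    {u} d≡0 lt = (λ _ → u) , refl , (λ _ ()) , λ { zero _ → d≡0 }
  geodesic (suc j) {u} d≡  lt with dist-pred d≡ lt
  ... | x , e , dx≡j with geodesic j dx≡j (<⇒≤ lt)
  ... | p , pj≡x , p-edge , p-dist = q , q-end , q-edge , q-dist
    where
    q : ℕ → Fin n
    q t = if does (t ≤? j) then p t else u
    q-old : ∀ {t} → t ≤ j → q t ≡ p t
    q-old {t} t≤j = if-yes (t ≤? j) t≤j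
    q-end : q (suc j) ≡ u
    q-end = if-no (suc j ≤? j) 1+n≰n
    q-edge : ∀ t → t < suc j → Edge (q t) (q (suc t))
    q-edge t lt with m≤n⇒m<n∨m≡n (≤-pred lt)
    ... | inj₁ t<j  = subst₂ Edge (sym (q-old (<⇒≤ t<j))) (sym (q-old t<j)) (p-edge t t<j)
    ... | inj₂ refl = subst₂ Edge (sym (trans (q-old ≤-refl) pj≡x)) (sym q-end) e
    q-dist : ∀ t → t ≤ suc j → dist (q t) ≡ t
    q-dist t le with m≤n⇒m<n∨m≡n le
    ... | inj₁ t<1+j = trans (cong dist (q-old (≤-pred t<1+j))) (p-dist t (≤-pred t<1+j))
    ... | inj₂ refl  = trans (cong dist q-end) d≡

  -- Vertices of a geodesic are at different distances from v, so that closing it yields a cycle.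
  in-neighbour-far : RFree r G → ∀ {u} → Edge u v → r ≤ dist u
  in-neighbour-far free {u} e = ≮⇒≥ λ near → close (dist u) refl near
    where
    close : ∀ j → dist u ≡ j → j < r → ⊥
    close zero d≡0 lt = loop-free (subst (λ x → Edge x v) (dist-zero d≡0 lt) e)
    close (suc k) d≡ lt with p , p-end , p-edge , p-dist ← geodesic (suc k) d≡ lt =
      -- The cycle has `k + 2` vertices, and `k + 2 ≤ r` since `u` is at distance `k + 1 < r`.
      free (suc (suc k)) lt record
        { vtx      = p ∘ toℕ
        ; distinct = λ {i} {j} pi≡pj → Fin.toℕ-injective
            (trans (sym (at i)) (trans (cong dist pi≡pj) (at j)))
        ; path     = λ i → subst (λ t → Edge (p t) (p (suc (toℕ i)))) (sym (Fin.toℕ-inject₁ i))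
            (p-edge (toℕ i) (Fin.toℕ<n i))
        ; closing  = subst₂ Edge (sym (trans (cong p (Fin.toℕ-fromℕ (suc k))) p-end))
            (sym (dist-zero (p-dist 0 z≤n) (≤-trans (s≤s z≤n) lt))) e
        }
      where
      at : ∀ (i : Fin (suc (suc k))) → dist (p (toℕ i)) ≡ toℕ i
      at i = p-dist (toℕ i) (≤-pred (Fin.toℕ<n i))

-- Sparse cuts

module SparseCut {n : ℕ} (G : Digraph n) (r : ℕ) (3≤r : 3 ≤ r) (free : RFree r G)
  {W : Pred (Fin n) 0ℓ} (W? : Decidable W) where

  open Edges G

  private
    open module D v = Distance G W? r v using (dist)
    open module L v = Layers W? (dist v) using (cross; cross?)
    0<r : 0 < r
    0<r = ≤-trans (s≤s z≤n) 3≤r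

  -- The literal is the right factor because 800 * x normalises to a sum of 800 copies of x.
  SparseCut : Set
  SparseCut = ∃ λ v → W v × ∃ λ i → i < r × r * r * cross v edge? i ≤ cross v nonAdj? i * 800

  private
    -- An edge x → y leaving the ball of radius 1 around v arises from a path v → x → y; then
    -- the non-adjacent pair {v , y} crosses the ball of radius 1 around x.
    two-path : ∀ {v x y} → W v → ((W x × dist v x ≤ 1) × (W y × 1 < dist v y)) × Edge x y →
               ((W y × dist x y ≤ 1) × (W v × 1 < dist x v)) × NonAdj y v
    two-path {v} {x} {y} wv (((wx , x≤1) , (wy , 1<y)) , xy) =
      ((wy , y-near) , (wv , ≤-trans (<⇒≤ 3≤r) (D.in-neighbour-far x free vx))) , y≢v , ¬yv , ¬vy
      where
      y≤2 : dist v y ≤ 2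
      y≤2 = ≤-trans (D.dist-edge v wx xy) (s≤s x≤1)
      x≡1 : dist v x ≡ 1
      x≡1 = ≤-antisym x≤1 (≤-pred (≤-trans 1<y (D.dist-edge v wx xy)))
      vx : Edge v x
      vx with u , ux , u≡0 ← D.dist-pred v x≡1 (<⇒≤ 3≤r) = subst (λ z → Edge z x) (D.dist-zero v u≡0 0<r) ux
      y-near : dist x y ≤ 1
      y-near = ≤-trans (D.dist-edge x wx xy) (s≤s (≤-reflexive (D.dist-root x)))
      y≢v : y ≢ v
      y≢v y≡v = n≮0 (≤-trans 1<y (≤-reflexive (trans (cong (dist v) y≡v) (D.dist-root v))))
      -- Such an edge would put `y` at distance at least `r ≥ 3`, yet `y` is at distance at most 2.
      ¬yv : ¬ Edge y v
      ¬yv yv = <⇒≱ 3≤r (≤-trans (D.in-neighbour-far v free yv) y≤2)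
      ¬vy : ¬ Edge v y
      ¬vy vy = <⇒≱ 1<y (≤-trans (D.dist-edge v wv vy) (s≤s (≤-reflexive (D.dist-root v))))

    -- `W v` is included so that sums over all vertices see only cuts around vertices of `W`.
    cuts? : {R : Fin n → Fin n → Set} → (∀ u v → Dec (R u v)) → ∀ v x y →
            Dec (W v × ((W x × dist v x ≤ 1) × (W y × 1 < dist v y)) × R x y)
    cuts? R? v x y = W? v ×-dec cross? v R? 1 x y

    -- `two-path` sends a triple `(v, x, y)` of an edge cut to the triple `(x, y, v)` of a
    -- non-adjacent cut. Rotating the coordinates does not change the total over all triples.
    total-cut : sum (λ v → ## (cuts? edge? v)) ≤ sum (λ v → ## (cuts? nonAdj? v))
    total-cut = begin
      sum (λ v → ## (cuts? edge? v))
        ≤⟨ sum-mono-≤ (λ v → ##-mono (cuts? edge? v) (λ x y → cuts? nonAdj? x y v)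
             (λ (wv , c) → proj₁ (proj₁ (proj₁ c)) , two-path wv c)) ⟩
      sum (λ v → ## (λ x y → cuts? nonAdj? x y v))
        ≡⟨ ##-rotate (cuts? nonAdj?) ⟩
      sum (λ v → ## (cuts? nonAdj? v))   ∎
      where open ≤-Reasoning

  -- If edges outnumbered non-adjacent pairs in every cut of radius 1, summing would contradict
  -- `total-cut`; `v₀` makes the sum strict. A cut without this excess suffices because
  -- `28 * 28 = 784 ≤ 800`.
  small-r : ∃ W → r ≤ 28 → SparseCut
  small-r (v₀ , w₀) r≤28 =
    [ (λ (v , w , e≤γ) → v , w , 1 , <⇒≤ 3≤r ,
        ≤-trans (*-mono-≤ (≤-trans (*-mono-≤ r≤28 r≤28) (m≤m+n 784 16)) e≤γ)
          (≤-reflexive (*-comm 800 (cross v nonAdj? 1))))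
    , (λ all-dense → ⊥-elim (dense all-dense))
    ]′ (toSum (Fin.any? λ v → W? v ×-dec (cross v edge? 1 ≤? cross v nonAdj? 1)))
    where
    dense : ¬ ∃ (λ v → W v × cross v edge? 1 ≤ cross v nonAdj? 1) → ⊥
    dense all-dense = <⇒≱ (sum-mono-< le v₀ (lt w₀)) total-cut
      where
      lt : ∀ {v} → W v → ## (cuts? nonAdj? v) < ## (cuts? edge? v)
      lt {v} w = begin-strict
        ## (cuts? nonAdj? v)     ≤⟨ ##-mono (cuts? nonAdj? v) (cross? v nonAdj? 1) proj₂ ⟩
        cross v nonAdj? 1        <⟨ ≰⇒> (λ e≤γ → all-dense (v , w , e≤γ)) ⟩
        cross v edge? 1          ≤⟨ ##-mono (cross? v edge? 1) (cuts? edge? v) (w ,_) ⟩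
        ## (cuts? edge? v)       ∎
        where open ≤-Reasoning
      le : ∀ v → ## (cuts? nonAdj? v) ≤ ## (cuts? edge? v)
      le v = [ (λ w → <⇒≤ (lt w)) , (λ ¬w → ##-mono (cuts? nonAdj? v) (cuts? edge? v) (⊥-elim ∘ ¬w ∘ proj₁)) ]′
        (toSum (W? v))

  nonDegree : Fin n → ℕ
  nonDegree v = # (λ u → W? u ×-dec nonAdj? v u)

  -- The lower bound on `r` makes room for two disjoint bands of `2 * suc k` levels among
  -- `2, … , r - 1`. The upper bound gives `r² ≤ 36 k² < 50 k²`.
  large-r : ∀ k → 4 * suc k + 2 ≤ r → r ≤ 6 * k →
            ∀ v → W v → (∀ {u} → W u → nonDegree v ≤ nonDegree u) → SparseCut
  large-r k fits r≤6k v w least =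
    [ (λ cut → v , w , cut) , (λ all-dense → ⊥-elim (dense all-dense)) ]′
      (toSum (anyUpTo? (λ i → r * r * cross v edge? i ≤? cross v nonAdj? i * 800) r))
    where
    open Layers W? (dist v) using (band?)
    m 2m δ : ℕ
    m = suc k
    2m = m + m
    δ = nonDegree v
    upper-fits : 1 + 2m + 2m < r
    upper-fits = ≤-trans (≤-reflexive (regroup m)) fits
      where
      regroup : ∀ m → 2 + (m + m) + (m + m) ≡ 4 * m + 2
      regroup = solve-∀
    lower-fits : 1 + 2m < r
    lower-fits = ≤-<-trans (m≤m+n (1 + 2m) 2m) upper-fits
    R<50k² : r * r < k * k * 50
    R<50k² = begin-strict
      r * r                ≤⟨ *-mono-≤ r≤6k r≤6k ⟩
      6 * k * (6 * k)      ≡⟨ regroup k ⟩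
      k * k * 36           <⟨ *-monoʳ-< (k * k) {{>-nonZero (*-mono-< k>0 k>0)}} (m≤m+n 37 13) ⟩
      k * k * 50           ∎
      where
      open ≤-Reasoning
      regroup : ∀ k → 6 * k * (6 * k) ≡ k * k * 36
      regroup = solve-∀
      k>0 : 0 < k
      k>0 = *-cancelˡ-< 6 0 k (≤-trans 0<r r≤6k)
    nonAdj-layer : ∀ {u} → W u × 1 < dist v u × dist v u < r → NonAdj v u
    nonAdj-layer {u} (wu , 1<u , u<r) =
      (λ { refl → n≮0 (≤-trans 1<u (≤-reflexive (D.dist-root v))) }) ,
      (λ vu → <⇒≱ 1<u (≤-trans (D.dist-edge v w vu) (s≤s (≤-reflexive (D.dist-root v))))) ,
      (λ uv → <⇒≱ u<r (D.in-neighbour-far v free uv))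
    both : # (band? 1 (1 + 2m)) + # (band? (1 + 2m) (1 + 2m + 2m)) ≤ δ
    both = #-disjoint (band? 1 (1 + 2m)) (band? (1 + 2m) (1 + 2m + 2m)) (λ u → W? u ×-dec nonAdj? v u)
      (λ (wu , l , u) → wu , nonAdj-layer (wu , l , ≤-<-trans u lower-fits))
      (λ (wu , l , u) → wu , nonAdj-layer (wu , ≤-trans (s≤s (m≤m+n 1 2m)) l , ≤-<-trans u upper-fits))
      (λ (_ , _ , u) (_ , l , _) → <⇒≱ l u)
    thin : 2 * # (band? 1 (1 + 2m)) ≤ δ ⊎ 2 * # (band? (1 + 2m) (1 + 2m + 2m)) ≤ δ
    thin = halve (# (band? 1 (1 + 2m))) _ both
    dense : ¬ ∃ (λ i → i < r × r * r * cross v edge? i ≤ cross v nonAdj? i * 800) → ⊥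
    dense all-dense = [ band-dense 1 lower-fits , band-dense (1 + 2m) upper-fits ]′ thin
      where
      band-dense : ∀ s → s + 2m < r → 2 * # (band? s (s + 2m)) ≤ δ → ⊥
      band-dense s fits thin = Window.thin-band-expands⇒⊥ W? (dist v) edge? nonAdj? nonAdj-sym
        (D.dist-edge v) (r * r) δ s k R<50k² least thin
        (λ i s<i i<e → ≰⇒> λ cut → all-dense (i , <-trans i<e fits , cut))

  least-nonDegree : ∃ W → ∃ λ v → W v × (∀ {u} → W u → nonDegree v ≤ nonDegree u)
  least-nonDegree nonempty = proj₁ v , proj₂ v , λ {u} wu → proj₂ minimum (u , wu)
    where
    smaller? : (a : ∃ W) → Dec (∃ λ (b : ∃ W) → nonDegree (proj₁ b) < nonDegree (proj₁ a))
    smaller? a = map′ (λ (v , w , p) → (v , w) , p) (λ ((v , w) , p) → v , w , p)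
      (Fin.any? λ v → W? v ×-dec nonDegree v <? nonDegree (proj₁ a))
    minimum : ∃ λ (a : ∃ W) → ∀ b → nonDegree (proj₁ a) ≤ nonDegree (proj₁ b)
    minimum = minimal (nonDegree ∘ proj₁) smaller? nonempty
    v : ∃ W
    v = proj₁ minimum

  sparse-cut : ∃ W → SparseCut
  sparse-cut nonempty = [ small-r nonempty , large ]′ (≤-<-connex r 28)
    where
    large : 28 < r → SparseCut
    large 28<r with v , w , least ← least-nonDegree nonempty = large-r k fits r≤6k v w least
      where
      -- `k` is the largest number with `4 * suc k + 2 ≤ r`. Then `r ≤ 4 k + 9`, and `r ≥ 29` gives
      -- `k ≥ 5`, hence `9 ≤ 2 k`.
      q k : ℕ
      q = r ∸ 6
      k = q / 4
      r≡ : r ≡ 6 + q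
      r≡ = sym (m+[n∸m]≡n (≤-trans (m≤m+n 6 23) 28<r))
      fits : 4 * suc k + 2 ≤ r
      fits = begin
        4 * suc k + 2   ≡⟨ regroup k ⟩
        6 + k * 4       ≤⟨ +-monoʳ-≤ 6 (m/n*n≤m q 4) ⟩
        6 + q           ≡⟨ r≡ ⟨
        r               ∎
        where
        open ≤-Reasoning
        regroup : ∀ k → 4 * (1 + k) + 2 ≡ 6 + k * 4
        regroup = solve-∀
      5≤k : 5 ≤ k
      5≤k = /-monoˡ-≤ 4 (∸-monoˡ-≤ 6 28<r)
      r≤6k : r ≤ 6 * k
      r≤6k = begin
        r                     ≡⟨ trans r≡ (cong (6 +_) (m≡m%n+[m/n]*n q 4)) ⟩
        6 + (q % 4 + k * 4)   ≤⟨ +-monoʳ-≤ 6 (+-monoˡ-≤ (k * 4) (≤-pred (m%n<n q 4))) ⟩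
        9 + k * 4             ≤⟨ +-monoˡ-≤ (k * 4) (≤-trans (m≤m+n 9 1) (*-monoʳ-≤ 2 5≤k)) ⟩
        2 * k + k * 4         ≡⟨ regroup k ⟩
        6 * k                 ∎
        where
        open ≤-Reasoning
        regroup : ∀ k → 2 * k + k * 4 ≡ 6 * k
        regroup = solve-∀

-- Recursive ranking

module Ranking {n : ℕ} (G : Digraph n) where

  open Edges G

  backward? : {W : Pred (Fin n) 0ℓ} → Decidable W → (f : Fin n → ℕ) → ∀ u v →
              Dec ((W u × W v) × Edge u v × f v ≤ f u)
  backward? W? f u v = (W? u ×-dec W? v) ×-dec edge? u v ×-dec f v ≤? f u

  missing? : {W : Pred (Fin n) 0ℓ} → Decidable W → ∀ u v → Dec ((W u × W v) × NonAdj u v)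
  missing? W? u v = (W? u ×-dec W? v) ×-dec nonAdj? u v

  -- Non-adjacent pairs are counted in both orders here, whence the factor 2.
  Ranking : ℕ → {W : Pred (Fin n) 0ℓ} → Decidable W → Set
  Ranking r W? = ∃ λ (f : Fin n → ℕ) → ∃ λ K → (∀ u → f u < K) ×
    r * r * (2 * ## (backward? W? f)) ≤ ## (missing? W?) * 800

  module Glue (r : ℕ) {W : Pred (Fin n) 0ℓ} (W? : Decidable W) (h : Fin n → ℕ) (i : ℕ) where

    open Layers W? h

    -- Shifting the ranks of the low part by `Kₕ` puts them above all ranks of the high part, so
    -- edges from high to low rise and the only new backward edges are those of the cut. The
    -- inequality `cut` is used doubled, since each non-adjacent pair across appears in both orders.
    glue : r * r * cross edge? i ≤ cross nonAdj? i * 800 →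
           Ranking r (low? i) → Ranking r (high? i) → Ranking r W?
    glue cut (fₗ , Kₗ , boundₗ , IHₗ) (fₕ , Kₕ , boundₕ , IHₕ) = f , Kₕ + Kₗ , bound , (begin
      r * r * (2 * ## (backward? W? f))
        ≤⟨ *-monoʳ-≤ (r * r) (*-monoʳ-≤ 2 backward-split) ⟩
      r * r * (2 * (## (backward? (low? i) fₗ) + (## (backward? (high? i) fₕ) + cross edge? i)))
        ≡⟨ expand (r * r) (## (backward? (low? i) fₗ)) (## (backward? (high? i) fₕ)) (cross edge? i) ⟩
      r * r * (2 * ## (backward? (low? i) fₗ)) +
        (r * r * (2 * ## (backward? (high? i) fₕ)) + 2 * (r * r * cross edge? i))
        ≤⟨ +-mono-≤ IHₗ (+-mono-≤ IHₕ (*-monoʳ-≤ 2 cut)) ⟩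
      ## (missing? (low? i)) * 800 + (## (missing? (high? i)) * 800 + 2 * (cross nonAdj? i * 800))
        ≡⟨ collect (## (missing? (low? i))) (## (missing? (high? i))) (cross nonAdj? i) ⟩
      (## (missing? (low? i)) + (## (missing? (high? i)) + (cross nonAdj? i + cross nonAdj? i))) * 800
        ≤⟨ *-monoˡ-≤ 800 missing-split ⟩
      ## (missing? W?) * 800   ∎)
      where
      open ≤-Reasoning
      expand : ∀ R x y z → R * (2 * (x + (y + z))) ≡ R * (2 * x) + (R * (2 * y) + 2 * (R * z))
      expand = solve-∀
      collect : ∀ x y z → x * 800 + (y * 800 + 2 * (z * 800)) ≡ (x + (y + (z + z))) * 800
      collect = solve-∀

      f : Fin n → ℕ
      f u = if does (h u ≤? i) then Kₕ + fₗ u else fₕ u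

      f-low : ∀ {u} → h u ≤ i → f u ≡ Kₕ + fₗ u
      f-low {u} u≤i = if-yes (h u ≤? i) u≤i

      f-high : ∀ {u} → i < h u → f u ≡ fₕ u
      f-high {u} i<u = if-no (h u ≤? i) (<⇒≱ i<u)

      bound : ∀ u → f u < Kₕ + Kₗ
      bound u =
        [ (λ u≤i → subst (_< Kₕ + Kₗ) (sym (f-low u≤i)) (+-monoʳ-< Kₕ (boundₗ u)))
        , (λ i<u → subst (_< Kₕ + Kₗ) (sym (f-high i<u)) (≤-trans (boundₕ u) (m≤m+n Kₕ Kₗ)))
        ]′ (≤-<-connex (h u) i)

      backward-split : ## (backward? W? f) ≤
        ## (backward? (low? i) fₗ) + (## (backward? (high? i) fₕ) + cross edge? i)
      backward-split = ≤-trans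
        (##-cover (backward? W? f) (backward? (low? i) fₗ) rest? cases)
        (+-monoʳ-≤ (## (backward? (low? i) fₗ))
          (##-cover rest? (backward? (high? i) fₕ) (cross? edge? i) id))
        where
        rest? : ∀ u v → Dec (((W u × i < h u) × (W v × i < h v)) × Edge u v × fₕ v ≤ fₕ u ⊎
                             ((W u × h u ≤ i) × (W v × i < h v)) × Edge u v)
        rest? u v = backward? (high? i) fₕ u v ⊎-dec cross? edge? i u v
        cases : ∀ {u v} → (W u × W v) × Edge u v × f v ≤ f u →
          ((W u × h u ≤ i) × (W v × h v ≤ i)) × Edge u v × fₗ v ≤ fₗ u ⊎
          ((W u × i < h u) × (W v × i < h v)) × Edge u v × fₕ v ≤ fₕ u ⊎
          ((W u × h u ≤ i) × (W v × i < h v)) × Edge u v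
        cases {u} {v} ((wu , wv) , uv , le) = place (≤-<-connex (h u) i) (≤-<-connex (h v) i)
          where
          place : h u ≤ i ⊎ i < h u → h v ≤ i ⊎ i < h v → _
          place (inj₁ u≤i) (inj₁ v≤i) = inj₁ (((wu , u≤i) , (wv , v≤i)) , uv ,
            +-cancelˡ-≤ Kₕ (fₗ v) (fₗ u) (subst₂ _≤_ (f-low v≤i) (f-low u≤i) le))
          place (inj₁ u≤i) (inj₂ i<v) = inj₂ (inj₂ (((wu , u≤i) , (wv , i<v)) , uv))
          place (inj₂ i<u) (inj₂ i<v) = inj₂ (inj₁ (((wu , i<u) , (wv , i<v)) , uv ,
            subst₂ _≤_ (f-high i<v) (f-high i<u) le))
          place (inj₂ i<u) (inj₁ v≤i) = ⊥-elim (<⇒≱ (boundₕ u)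
            (≤-trans (m≤m+n Kₕ (fₗ v)) (subst₂ _≤_ (f-low v≤i) (f-high i<u) le)))

      missing-split : ## (missing? (low? i)) + (## (missing? (high? i)) + (cross nonAdj? i + cross nonAdj? i)) ≤
                      ## (missing? W?)
      missing-split = begin
        ## (missing? (low? i)) + (## (missing? (high? i)) + (cross nonAdj? i + cross nonAdj? i))
          ≡⟨ cong (λ z → ## (missing? (low? i)) + (## (missing? (high? i)) + (cross nonAdj? i + z))) (##-swap (cross? nonAdj? i)) ⟩
        ## (missing? (low? i)) + (## (missing? (high? i)) + (cross nonAdj? i + ## (flip (cross? nonAdj? i))))
          ≤⟨ +-monoʳ-≤ (## (missing? (low? i))) (+-monoʳ-≤ (## (missing? (high? i)))
               (##-disjoint (cross? nonAdj? i) (flip (cross? nonAdj? i)) mixed? inj₁ inj₂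
                 (λ (((_ , u≤i) , _) , _) ((_ , (_ , i<u)) , _) → <⇒≱ i<u u≤i))) ⟩
        ## (missing? (low? i)) + (## (missing? (high? i)) + ## mixed?)
          ≤⟨ +-monoʳ-≤ (## (missing? (low? i))) (##-disjoint (missing? (high? i)) mixed? outer? inj₁ inj₂
               (λ { (((_ , i<u) , _) , _) (inj₁ (((_ , u≤i) , _) , _)) → <⇒≱ i<u u≤i
                  ; ((_ , (_ , i<v)) , _) (inj₂ (((_ , v≤i) , _) , _)) → <⇒≱ i<v v≤i })) ⟩
        ## (missing? (low? i)) + ## outer?
          ≤⟨ ##-disjoint (missing? (low? i)) outer? (missing? W?)
               (λ (((wu , _) , (wv , _)) , nuv) → (wu , wv) , nuv)
               (λ { (inj₁ (((wu , _) , (wv , _)) , nuv)) → (wu , wv) , nuv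
                  ; (inj₂ (inj₁ (((wu , _) , (wv , _)) , nuv))) → (wu , wv) , nuv
                  ; (inj₂ (inj₂ (((wv , _) , (wu , _)) , nvu))) → (wu , wv) , nonAdj-sym nvu })
               (λ { (((_ , u≤i) , _) , _) (inj₁ (((_ , i<u) , _) , _)) → <⇒≱ i<u u≤i
                  ; ((_ , (_ , v≤i)) , _) (inj₂ (inj₁ ((_ , (_ , i<v)) , _))) → <⇒≱ i<v v≤i
                  ; (((_ , u≤i) , _) , _) (inj₂ (inj₂ ((_ , (_ , i<u)) , _))) → <⇒≱ i<u u≤i }) ⟩
        ## (missing? W?)   ∎
        where
        mixed? : ∀ u v → Dec (((W u × h u ≤ i) × (W v × i < h v)) × NonAdj u v ⊎
                              ((W v × h v ≤ i) × (W u × i < h u)) × NonAdj v u)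
        mixed? u v = cross? nonAdj? i u v ⊎-dec cross? nonAdj? i v u
        outer? : ∀ u v → Dec (((W u × i < h u) × (W v × i < h v)) × NonAdj u v ⊎
                              ((W u × h u ≤ i) × (W v × i < h v)) × NonAdj u v ⊎
                              ((W v × h v ≤ i) × (W u × i < h u)) × NonAdj v u)
        outer? u v = missing? (high? i) u v ⊎-dec mixed? u v

  zero-ranking : ∀ r {W : Pred (Fin n) 0ℓ} (W? : Decidable W) → (∀ {u v} → W u → W v → ¬ Edge u v) → Ranking r W?
  zero-ranking r W? edgeless = (λ _ → 0) , 1 , (λ _ → s≤s z≤n) , ≤-trans (≤-reflexive none) z≤n
    where
    none : r * r * (2 * ## (backward? W? (λ _ → 0))) ≡ 0
    none = trans
      (cong (λ z → r * r * (2 * z))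
        (##-empty (backward? W? (λ _ → 0)) (λ { _ _ ((wu , wv) , uv , _) → edgeless wu wv uv })))
      (*-zeroʳ (r * r))

  module _ (r : ℕ) (3≤r : 3 ≤ r) (free : RFree r G) where

    -- With `h` the indicator of `v`, the high part is `v` alone. No edge from `W` enters it, so
    -- nothing is cut, and `v` is ranked below the rest.
    split-source : {W : Pred (Fin n) 0ℓ} (W? : Decidable W) → ∀ v → W v → ¬ ∃ (λ u → W u × Edge u v) →
                   (∀ {P : Pred (Fin n) 0ℓ} (P? : Decidable P) → # P? < # W? → Ranking r P?) → Ranking r W?
    split-source W? v wv source IH = glue (≤-trans (≤-reflexive uncut) z≤n)
      (IH (low? 0) (#-mono-< (low? 0) W? proj₁ v (λ (_ , v≤0) → 1+n≰n (≤-trans (≤-reflexive (sym h-v)) v≤0)) wv))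
      (zero-ranking r (high? 0) (λ (_ , h-x) (_ , h-y) xy → loop-free (subst₂ Edge (only-v h-x) (only-v h-y) xy)))
      where
      h : Fin n → ℕ
      h u = 𝟙 (u Fin.≟ v)
      h-v : h v ≡ 1
      h-v = if-yes (v Fin.≟ v) refl
      only-v : ∀ {u} → 0 < h u → u ≡ v
      only-v {u} = 𝟙-pos (u Fin.≟ v)
      open Layers W? h
      open Glue r W? h 0
      uncut : r * r * cross edge? 0 ≡ 0
      uncut = trans
        (cong (r * r *_) (##-empty (cross? edge? 0) (λ { u w (((wu , _) , (_ , w>0)) , uw) →
          source (u , wu , subst (Edge u) (only-v w>0) uw) })))
        (*-zeroʳ (r * r))

    -- Both parts must be smaller than `W`. The ball contains `v` and misses an in-neighbour of `v`,
    -- which is at distance at least `r > i`. Without an in-neighbour in `W` the ball might be all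
    -- of `W`, so `v` is split off instead.
    split-ball : {W : Pred (Fin n) 0ℓ} (W? : Decidable W) → SparseCut.SparseCut G r 3≤r free W? →
                 (∀ {P : Pred (Fin n) 0ℓ} (P? : Decidable P) → # P? < # W? → Ranking r P?) → Ranking r W?
    split-ball {W} W? (v , wv , i , i<r , cut) IH =
      [ inner , (λ source → split-source W? v wv source IH) ]′ (toSum (Fin.any? λ u → W? u ×-dec edge? u v))
      where
      module D = Distance G W? r v
      open Layers W? D.dist using (low?; high?)
      inner : ∃ (λ u → W u × Edge u v) → Ranking r W?
      inner (u , wu , uv) = Glue.glue r W? D.dist i cut
        (IH (low? i) (#-mono-< (low? i) W? proj₁ u
          (λ (_ , u≤i) → <⇒≱ i<r (≤-trans (D.in-neighbour-far free uv) u≤i)) wu))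
        (IH (high? i) (#-mono-< (high? i) W? proj₁ v
          (λ (_ , i<v) → n≮0 (≤-trans i<v (≤-reflexive D.dist-root))) wv))

    ranking : {W : Pred (Fin n) 0ℓ} (W? : Decidable W) → Acc _<_ (# W?) → Ranking r W?
    ranking W? (acc smaller) =
      [ (λ nonempty → split-ball W? (SparseCut.sparse-cut G r 3≤r free W? nonempty)
          (λ P? P<W → ranking P? (smaller P<W)))
      , (λ empty → zero-ranking r W? (λ wu _ _ → empty (_ , wu)))
      ]′ (toSum (Fin.any? W?))

-- Unordered pairs and the feedback arc set

module _ {n : ℕ} (G : Digraph n) where

  open Edges G
  open Ranking G

  missing-≤-2gamma : ## (missing? {W = λ _ → ⊤} (λ _ → yes tt)) ≤ 2 * gamma G
  missing-≤-2gamma = begin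
    ## all?                              ≤⟨ ##-cover all? ordered? (flip ordered?) cases ⟩
    ## ordered? + ## (flip ordered?)     ≡⟨ cong (## ordered? +_) (##-swap ordered?) ⟨
    ## ordered? + ## ordered?            ≡⟨ cong (λ z → z + z) (countPairs-does ordered?) ⟨
    gamma G + gamma G                    ≡⟨ cong (gamma G +_) (+-identityʳ (gamma G)) ⟨
    2 * gamma G                          ∎
    where
    open ≤-Reasoning
    all? : ∀ u v → Dec ((⊤ × ⊤) × NonAdj u v)
    all? = missing? (λ _ → yes tt)
    ordered? : ∀ u v → Dec (T ((toℕ u <ᵇ toℕ v) ∧ not (edge G u v) ∧ not (edge G v u)))
    ordered? u v = T? ((toℕ u <ᵇ toℕ v) ∧ not (edge G u v) ∧ not (edge G v u))
    build : ∀ {u v} → toℕ u < toℕ v → ¬ Edge u v → ¬ Edge v u →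
            T ((toℕ u <ᵇ toℕ v) ∧ not (edge G u v) ∧ not (edge G v u))
    build {u} {v} lt ¬uv ¬vu rewrite Bool.¬-not ¬uv | Bool.¬-not ¬vu | Bool.∧-identityʳ (toℕ u <ᵇ toℕ v) = <⇒<ᵇ lt
    cases : ∀ {u v} → (⊤ × ⊤) × NonAdj u v →
            T ((toℕ u <ᵇ toℕ v) ∧ not (edge G u v) ∧ not (edge G v u)) ⊎
            T ((toℕ v <ᵇ toℕ u) ∧ not (edge G v u) ∧ not (edge G u v))
    cases {u} {v} (_ , u≢v , ¬uv , ¬vu) with <-cmp (toℕ u) (toℕ v)
    ... | tri< lt _ _ = inj₁ (build lt ¬uv ¬vu)
    ... | tri≈ _ eq _ = ⊥-elim (u≢v (Fin.toℕ-injective eq))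
    ... | tri> _ _ gt = inj₂ (build gt ¬vu ¬uv)

-- From the first vertex of a cycle to the last `f` does not drop, yet the closing edge would have
-- to rise back to the first.
increasing⇒acyclic : ∀ {n} {E : Fin n → Fin n → Bool} (f : Fin n → ℕ) →
                     (∀ {u v} → E u v ≡ true → f u < f v) → Acyclic E
increasing⇒acyclic {n} {E} f up (suc (suc k)) c = <⇒≱ (up closing) (climb (suc k) vtx path)
  where
  open DirCycle c
  climb : ∀ k (w : Fin (suc k) → Fin n) → (∀ i → E (w (inject₁ i)) (w (suc i)) ≡ true) →
          f (w zero) ≤ f (w (fromℕ k))
  climb zero    w step = ≤-refl
  climb (suc k) w step = ≤-trans (<⇒≤ (up (step zero))) (climb k (w ∘ suc) (step ∘ suc))

theorem1p1 : (r : ℕ) → 3 ≤ r → (n : ℕ) → (G : Digraph n) → RFree r G →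
    Σ (Fin n → Fin n → Bool) (λ X →
    IsFeedbackArcSet G X × (r * r) * countPairs X ≤ 800 * gamma G)
theorem1p1 r 3≤r n G free =
  (λ u v → does (X? u v)) , ((λ u v x → proj₁ (holds x)) , increasing⇒acyclic f forward) ,
  cancel-2 (r * r) (countPairs (λ u v → does (X? u v))) (gamma G) small
  where
  open Edges G
  open Ranking G using (Ranking; ranking; backward?; missing?)
  ranked : Ranking r {W = λ _ → ⊤} (λ _ → yes tt)
  ranked = ranking r 3≤r free (λ _ → yes tt) (<-wellFounded _)
  f : Fin n → ℕ
  f = proj₁ ranked
  -- The edges that do not rise in rank are removed, so `f` increases along all others.
  X? : ∀ u v → Dec (Edge u v × f v ≤ f u)
  X? u v = edge? u v ×-dec f v ≤? f u
  holds : ∀ {u v} → does (X? u v) ≡ true → Edge u v × f v ≤ f u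
  holds {u} {v} x = invert (subst (Reflects _) x (proof (X? u v)))
  forward : ∀ {u v} → edge G u v ∧ not (does (X? u v)) ≡ true → f u < f v
  forward {u} {v} kept = ≰⇒> λ v≤u →
    case trans (sym (Bool.∧-conicalʳ (edge G u v) _ kept))
      (cong not (dec-true (X? u v) (Bool.∧-conicalˡ (edge G u v) _ kept , v≤u))) of λ ()
  small : r * r * (2 * countPairs (λ u v → does (X? u v))) ≤ 2 * gamma G * 800
  small = begin
    r * r * (2 * countPairs (λ u v → does (X? u v)))
      ≡⟨ cong (λ z → r * r * (2 * z)) (countPairs-does X?) ⟩
    r * r * (2 * ## X?)
      ≤⟨ *-monoʳ-≤ (r * r) (*-monoʳ-≤ 2 (##-mono X? (backward? (λ _ → yes tt) f) ((tt , tt) ,_))) ⟩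
    r * r * (2 * ## (backward? {W = λ _ → ⊤} (λ _ → yes tt) f))
      ≤⟨ proj₂ (proj₂ (proj₂ ranked)) ⟩
    ## (missing? {W = λ _ → ⊤} (λ _ → yes tt)) * 800
      ≤⟨ *-monoˡ-≤ 800 (missing-≤-2gamma G) ⟩
    2 * gamma G * 800   ∎
    where open ≤-Reasoning
  -- The factor 2 stems from counting non-adjacent pairs in both orders.
  cancel-2 : ∀ R x g → R * (2 * x) ≤ 2 * g * 800 → R * x ≤ 800 * g
  cancel-2 R x g h = *-cancelˡ-≤ 2 (≤-trans (≤-reflexive (left R x)) (≤-trans h (≤-reflexive (right g))))
    where
    left : ∀ R x → 2 * (R * x) ≡ R * (2 * x)
    left = solve-∀
    right : ∀ g → 2 * g * 800 ≡ 2 * (800 * g)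
    right = solve-∀
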